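{- Let $n\ge 1$. A word $w$ over $[n]$ fixes all $n$-component acyclic networks if and only if $w$ is $n$-complete. Hence $\lambda_A(n)=\lambda(n)$.
   Context: An $n$-component (Boolean) network is a function $f=(f_1,\dots,f_n):\{0,1\}^n\to\{0,1\}^n$. Write $[n]=\{1,\dots,n\}$. The interaction graph of $f$ is the directed graph on $[n]$ (loops allowed) with an edge from $j$ to $i$ iff there exist $x,y$ differing only in component $j$ with $f_i(x)\ne f_i(y)$; $f$ is acyclic if its interaction graph has no directed cycle (in particular no loop). For $i\in[n]$, $f^i(x):=(x_1,\dots,x_{i-1},f_i(x),x_{i+1},\dots,x_n)$, and for a word $w=i_1\dots i_k$ over $[n]$, $f^w:=f^{i_k}\circ\cdots\circ f^{i_1}$ (identity for the empty word). A word $w$ fixes $f$ if $f^w(x)$ is a fixed point of $f$ for every $x$. $\lambda_A(n)$ is the minimum length of a single word fixing all $n$-component acyclic networks. A word is $n$-complete if it contains every permutation of $[n]$ (viewed as a word using each letter once) as a (not necessarily contiguous) subsequence; $\lambda(n)$ is the length of a shortest $n$-complete word. -}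

module Defs where

open import Data.Bool.Base using (Bool)
open import Data.Fin.Base using (Fin)
open import Data.Fin.Permutation using (Permutation′; _⟨$⟩ʳ_)
open import Data.List.Base using (List; foldl; length; tabulate)
open import Data.List.Relation.Binary.Sublist.Propositional using (_⊆_)
open import Data.Nat.Base using (ℕ; _≤_)
open import Data.Nat.Properties using (≤-antisym)
open import Data.Product.Base using (_×_; _,_; ∃-syntax)
open import Data.Vec.Base using (Vec; lookup; _[_]≔_)
open import Level using (0ℓ)
open import Relation.Binary.Construct.Closure.Transitive using (TransClosure)
open import Relation.Binary.Core using (Rel)
open import Relation.Binary.PropositionalEquality using (_≡_; _≢_; refl)
open import Relation.Nullary.Negation using (¬_)
open import Relation.Unary using (Pred)

State : ℕ → Set
State n = Vec Bool n

Network : ℕ → Set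
Network n = State n → State n

Word : ℕ → Set
Word n = List (Fin n)

component : ∀ {n} → Network n → Fin n → State n → Bool
component f i x = lookup (f x) i

DifferOnlyAt : ∀ {n} → Fin n → Rel (State n) 0ℓ
DifferOnlyAt j x y =
  lookup x j ≢ lookup y j × (∀ k → k ≢ j → lookup x k ≡ lookup y k)

-- InteractionGraph f j i: there is an edge from j to i.
InteractionGraph : ∀ {n} → Network n → Rel (Fin n) 0ℓ
InteractionGraph f j i =
  ∃[ x ] ∃[ y ] DifferOnlyAt j x y × component f i x ≢ component f i y

-- A directed graph has a directed cycle (or loop) exactly when some vertex
-- is reachable from itself by a walk of positive length.
Acyclic : ∀ {n} → Network n → Set
Acyclic f = ∀ i → ¬ TransClosure (InteractionGraph f) i i

update : ∀ {n} → Network n → Fin n → State n → State n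
update f i x = x [ i ]≔ component f i x

-- A left fold, since the first letter of the word is applied first.
updateWord : ∀ {n} → Network n → Word n → State n → State n
updateWord f w x = foldl (λ y i → update f i y) x w

FixedPoint : ∀ {n} → Network n → State n → Set
FixedPoint f x = f x ≡ x

Fixes : ∀ {n} → Word n → Network n → Set
Fixes w f = ∀ x → FixedPoint f (updateWord f w x)

FixesAllAcyclic : ∀ {n} → Word n → Set
FixesAllAcyclic {n} w = (f : Network n) → Acyclic f → Fixes w f

permutationWord : ∀ {n} → Permutation′ n → Word n
permutationWord π = tabulate (π ⟨$⟩ʳ_)

-- _⊆_ is the order-preserving, not necessarily contiguous, sublist relation.
Complete : ∀ {n} → Word n → Set
Complete {n} w = (π : Permutation′ n) → permutationWord π ⊆ w

IsMinLength : ∀ {n} → Pred (Word n) 0ℓ → ℕ → Set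
IsMinLength P k = (∃[ w ] P w × length w ≡ k) × (∀ w → P w → k ≤ length w)

IsMinLength-unique : ∀ {n} {P : Pred (Word n) 0ℓ} {k l} →
                     IsMinLength P k → IsMinLength P l → k ≡ l
IsMinLength-unique ((v , Pv , refl) , k≤) ((w , Pw , refl) , l≤) =
  ≤-antisym (k≤ w Pw) (l≤ v Pv)

-- The numbers λ_A(n) and λ(n) are given by their graphs: IsλA n k says that
-- λ_A(n) exists and equals k, and Isλ n k that λ(n) exists and equals k.
IsλA : ℕ → ℕ → Set
IsλA n = IsMinLength (FixesAllAcyclic {n})

Isλ : ℕ → ℕ → Set
Isλ n = IsMinLength (Complete {n})

{-# OPTIONS --safe #-}
-- An acyclic network has a topological ordering π of its interaction graph, and
-- updating along any word containing π settles the components in that order; so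
-- complete words fix all acyclic networks. Conversely, for a permutation π let every
-- component be the conjunction of the components preceding it in π. The only fixed
-- point of this acyclic network is all-true, and from the all-false state a component
-- can only become true after its predecessors have, so a word that fixes the network
-- contains π. Minimal lengths exist because completeness is decidable and the n-fold
-- repetition of 1 … n is complete.
module Submission where

open import Defs
open import Data.Bool.Base using (true; false)
import Data.Bool.Properties as Bool
open import Data.Fin.Base as Fin using (Fin; zero; suc; punchIn)
open import Data.Fin.Induction using (<-wellFounded; spo-wellFounded)
open import Data.Fin.Permutation as Perm
  using (Permutation′; _⟨$⟩ʳ_; _⟨$⟩ˡ_; _≈_; insert; remove; insert-punchIn; insert-remove;
         inverseˡ; inverseʳ)
open import Data.Fin.Properties using (_≟_; _<?_; any?; all?)
open import Data.Fin.Subset.Properties using (anySubset?)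
open import Data.List.Base using ([]; _∷_; length; tabulate; allFin; concat; replicate)
open import Data.List.Membership.Propositional using (_∈_; _∉_)
open import Data.List.Membership.Propositional.Properties using (∈-tabulate⁺; ∈-allFin)
open import Data.List.Properties using (length-tabulate; tabulate-cong)
open import Data.List.Relation.Binary.Sublist.Propositional using (_⊆_; []; _∷_; _∷ʳ_; minimum; from∈)
open import Data.List.Relation.Binary.Sublist.Propositional.Properties using (++⁺)
open import Data.List.Relation.Unary.All as All using (All; []; _∷_)
open import Data.List.Relation.Unary.AllPairs using (AllPairs; []; _∷_)
import Data.List.Relation.Unary.AllPairs.Properties as AllPairs
open import Data.List.Relation.Unary.Any using (here; there)
open import Data.Nat.Base using (ℕ; zero; suc; _<_; _≥_; s<s⁻¹)
import Data.Nat.Induction as ℕ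
open import Data.Nat.Properties using (anyUpTo?; ≮⇒≥)
open import Data.Product.Base using (_×_; _,_; ∃-syntax; Σ-syntax; map₂)
open import Data.Vec.Base as Vec using (Vec; []; _∷_; lookup; _[_]≔_; fromList; toList)
open import Data.Vec.Properties
  using (lookup∘update; lookup∘update′; []≔-lookup; lookup∘tabulate; lookup-replicate;
         length-toList; toList∘fromList)
open import Data.Vec.Relation.Binary.Pointwise.Extensional using (ext; Pointwise-≡⇒≡)
open import Function.Base using (_∘_; _on_; flip; case_of_)
open import Function.Bundles using (_⇔_; mk⇔; Equivalence)
open import Induction.WellFounded using (WellFounded; Acc; acc; wf⇒asym)
open import Level using (0ℓ)
open import Relation.Binary.Construct.Closure.Transitive
  using (TransClosure; [_]; _∷_; _++_; wellFounded⁻; wellFounded)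
import Relation.Binary.Construct.On as On
open import Relation.Binary.Core using (Rel; _⇒_)
import Relation.Binary.Definitions as Binary
open import Relation.Binary.PropositionalEquality
  using (_≡_; _≢_; refl; sym; trans; cong; subst; resp₂; isEquivalence)
open import Relation.Nullary.Decidable
  using (Dec; yes; no; does; map′; ¬?; _×-dec_; _→-dec_; decidable-stable; dec-true; dec-false; does-⇔)
open import Relation.Nullary.Negation using (¬_; contradiction)
open import Relation.Unary using (Pred; Decidable)

private
  variable
    n : ℕ

-- Topological sorting

-- Acyclicity makes the transitive closure a strict partial order, which is well-founded on a finite
-- set; this descends to single edges.
acyclic⇒wellFounded : (f : Network n) → Acyclic f → WellFounded (InteractionGraph f)
acyclic⇒wellFounded f acyclic = wellFounded⁻ _ (spo-wellFounded record
  { isEquivalence = isEquivalence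
  ; irrefl        = λ { refl → acyclic _ }
  ; trans         = _++_
  ; <-resp-≈      = resp₂ _
  })

interactionGraph? : (f : Network n) → Binary.Decidable (InteractionGraph f)
interactionGraph? f j i =
  -- A subset of `Fin n` is a Boolean vector, so a search over subsets is a search over states.
  anySubset? λ x → anySubset? λ y →
    (¬? (lookup x j Bool.≟ lookup y j)
      ×-dec all? λ k → ¬? (k ≟ j) →-dec (lookup x k Bool.≟ lookup y k))
    ×-dec ¬? (component f i x Bool.≟ component f i y)

-- Walking backwards along edges must stop, and it can only stop at a vertex without predecessors.
wellFounded⇒source : {R : Rel (Fin (suc n)) 0ℓ} → Binary.Decidable R → WellFounded R →
                     ∃[ m ] ∀ j → ¬ R j m
wellFounded⇒source {n} {R} R? wf = descend zero (wf zero)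
  where
  descend : ∀ i → Acc R i → ∃[ m ] ∀ j → ¬ R j m
  descend i (acc rs) with any? (λ j → R? j i)
  ... | yes (j , Rji) = descend j (rs Rji)
  ... | no  ∄R        = i , λ j Rji → ∄R (j , Rji)

topologicalSort : {R : Rel (Fin n) 0ℓ} → Binary.Decidable R → WellFounded R →
                  Σ[ π ∈ Permutation′ n ] ∀ {i j} → i Fin.< j → ¬ R (π ⟨$⟩ʳ j) (π ⟨$⟩ʳ i)
topologicalSort {zero}  R? wf = Perm.id , λ { {()} }
topologicalSort {suc n} {R} R? wf
  with m , source  ← wellFounded⇒source R? wf
  with π , π-sorts ← topologicalSort {R = R on punchIn m}
                       (λ i j → R? (punchIn m i) (punchIn m j))
                       (On.wellFounded (punchIn m) wf)
  -- The source `m` comes first; the other vertices, indexed through `punchIn m`, follow in their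
  -- sorted order.
  = insert zero m π , sorts
  where
  sorts : ∀ {i j} → i Fin.< j → ¬ R (insert zero m π ⟨$⟩ʳ j) (insert zero m π ⟨$⟩ʳ i)
  sorts {zero}          _   = source _
  sorts {suc i} {suc j} i<j
    rewrite insert-punchIn zero m π i | insert-punchIn zero m π j = π-sorts (s<s⁻¹ i<j)

-- Complete words fix acyclic networks

module _ (f : Network n) where

  private
    E = InteractionGraph f

  Settled : State n → Fin n → Set
  Settled x i = component f i x ≡ lookup x i

  update-edge : ∀ {i j} x → component f i (update f j x) ≢ component f i x → E j i
  update-edge {i} {j} x f≢ = update f j x , x , (x′≢x , λ k k≢j → lookup∘update′ k≢j x _) , f≢
    where
    -- Otherwise the update would leave the whole state unchanged, contradicting `f≢`.
    x′≢x : lookup (update f j x) j ≢ lookup x j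
    x′≢x eq = f≢ (cong (component f i)
      (trans (cong (x [ j ]≔_) (trans (sym (lookup∘update j x _)) eq)) ([]≔-lookup x j)))

  settled⇒update-id : ∀ {j x} → Settled x j → update f j x ≡ x
  settled⇒update-id {j} {x} s = trans (cong (x [ j ]≔_) s) ([]≔-lookup x j)

  update-settles : ∀ {j} x → ¬ E j j → Settled (update f j x) j
  update-settles {j} x ¬Ejj =
    trans (decidable-stable (_ Bool.≟ _) (¬Ejj ∘ update-edge x)) (sym (lookup∘update j x _))

  -- If updating `j` changes the value of `f` at `i`, there is an edge from `j` to `i`; then `j` was
  -- already settled and the update did nothing.
  settled-update : ∀ {i j x} → i ≢ j → (E j i → Settled x j) →
                   Settled x i → Settled (update f j x) i
  settled-update {i} {j} {x} i≢j pred s with component f i (update f j x) Bool.≟ component f i x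
  ... | yes eq = trans eq (trans s (sym (lookup∘update′ i≢j x _)))
  ... | no  f≢ = subst (λ y → Settled y i) (sym (settled⇒update-id (pred (update-edge x f≢)))) s

  -- Induction on the embedding, with `l` the letters still to be matched. The components outside
  -- `l` are settled and closed under predecessors, so every update keeps them settled.
  updateWord-settles : (∀ i → ¬ E i i) → ∀ {l w} → l ⊆ w →
                       AllPairs (λ i j → ¬ E j i) l →
                       (∀ {i j} → E j i → i ∉ l → j ∉ l) →
                       ∀ x → (∀ i → i ∉ l → Settled x i) →
                       ∀ i → Settled (updateWord f w x) i
  updateWord-settles loopless []         _      closed x s i = s i λ ()
  updateWord-settles loopless {l} (j ∷ʳ l⊆w) sorted closed x s =
    updateWord-settles loopless l⊆w sorted closed (update f j x) s′
    where
    s′ : ∀ i → i ∉ l → Settled (update f j x) i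
    s′ i i∉l with i ≟ j
    ... | yes refl = update-settles x (loopless i)
    ... | no  i≢j  = settled-update i≢j (λ Eji → s j (closed Eji i∉l)) (s i i∉l)
  updateWord-settles loopless {j ∷ l} (refl ∷ l⊆w) (j-first ∷ sorted) closed x s =
    updateWord-settles loopless l⊆w sorted closed′ (update f j x) s′
    where
    ∉-∷ : ∀ {i} → i ≢ j → i ∉ l → i ∉ j ∷ l
    ∉-∷ i≢j i∉l (here i≡j)  = i≢j i≡j
    ∉-∷ i≢j i∉l (there i∈l) = i∉l i∈l

    closed′ : ∀ {i k} → E k i → i ∉ l → k ∉ l
    closed′ {i} Eki i∉l k∈l with i ≟ j
    -- No letter after `j` has an edge into `j`, so `j` may leave `l`.
    ... | yes refl = All.lookup j-first k∈l Eki
    ... | no  i≢j  = closed Eki (∉-∷ i≢j i∉l) (there k∈l)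

    s′ : ∀ i → i ∉ l → Settled (update f j x) i
    s′ i i∉l with i ≟ j
    ... | yes refl = update-settles x (loopless i)
    ... | no  i≢j  = settled-update i≢j
      (λ Eji → contradiction (here refl) (closed Eji (∉-∷ i≢j i∉l))) (s i (∉-∷ i≢j i∉l))

complete⇒fixesAllAcyclic : (w : Word n) → Complete w → FixesAllAcyclic w
complete⇒fixesAllAcyclic w complete f acyclic x
  with π , π-sorts ← topologicalSort (interactionGraph? f) (acyclic⇒wellFounded f acyclic)
  -- Every component occurs in the permutation word, so both conditions on components outside it
  -- hold vacuously.
  = Pointwise-≡⇒≡ (ext (updateWord-settles f (λ i Eii → acyclic i [ Eii ]) (complete π)
      (AllPairs.tabulate⁺-< π-sorts)
      (λ _ i∉π → contradiction (∈π _) i∉π) x (λ i i∉π → contradiction (∈π i) i∉π)))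
  where
  ∈π : ∀ i → i ∈ permutationWord π
  ∈π i = subst (_∈ permutationWord π) (inverseʳ π) (∈-tabulate⁺ (π ⟨$⟩ˡ i))

-- Conjunctive networks

module Conjunctive {R : Rel (Fin n) 0ℓ} (R? : Binary.Decidable R) (wf : WellFounded R) where

  predecessorsTrue? : ∀ i x → Dec (∀ j → R j i → lookup x j ≡ true)
  predecessorsTrue? i x = all? λ j → R? j i →-dec (lookup x j Bool.≟ true)

  conjunction : Network n
  conjunction x = Vec.tabulate λ i → does (predecessorsTrue? i x)

  component≡does : ∀ i x → component conjunction i x ≡ does (predecessorsTrue? i x)
  component≡does i x = lookup∘tabulate _ i

  -- Without `R j i`, a change in component `j` alone leaves every conjunct of component `i` as it
  -- was.
  interaction⇒R : InteractionGraph conjunction ⇒ R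
  interaction⇒R {j} {i} (x , y , (_ , agree) , f≢) = decidable-stable (R? j i) λ ¬Rji →
    let agreeOnPredecessors : ∀ k → R k i → lookup x k ≡ lookup y k
        agreeOnPredecessors k Rki = agree k λ { refl → ¬Rji Rki }
    in f≢ (trans (component≡does i x) (trans
      (does-⇔ (mk⇔ (λ t k Rki → trans (sym (agreeOnPredecessors k Rki)) (t k Rki))
                   (λ t k Rki → trans (agreeOnPredecessors k Rki) (t k Rki)))
              (predecessorsTrue? i x) (predecessorsTrue? i y))
      (sym (component≡does i y))))

  acyclic : Acyclic conjunction
  acyclic i Eii⁺ = wf⇒asym (wellFounded _ wf) Rii⁺ Rii⁺
    where
    embed : ∀ {j k} → TransClosure (InteractionGraph conjunction) j k → TransClosure R j k
    embed [ e ]   = [ interaction⇒R e ]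
    embed (e ∷ p) = interaction⇒R e ∷ embed p

    Rii⁺ = embed Eii⁺

  fixedPoint⇒true : ∀ {x} → FixedPoint conjunction x → ∀ i → lookup x i ≡ true
  fixedPoint⇒true {x} fixed i = go i (wf i)
    where
    go : ∀ i → Acc R i → lookup x i ≡ true
    go i (acc rs) = trans (cong (flip lookup i) (sym fixed))
      (trans (component≡does i x)
        (dec-true (predecessorsTrue? i x) λ j Rji → go j (rs Rji)))

  false-predecessor : ∀ {i j} x → R j i → lookup x j ≡ false → component conjunction i x ≡ false
  false-predecessor {i} {j} x Rji xⱼ≡false = trans (component≡does i x)
    (dec-false (predecessorsTrue? i x)
      λ t → case trans (sym xⱼ≡false) (t j Rji) of λ ())

  -- Here `l` lists the letters still to be matched, all false. Updating the head consumes it. Any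
  -- other letter of `l` has the false head as a predecessor, so its update yields false.
  true⇒⊆ : ∀ {l} w x → AllPairs R l → All (λ i → lookup x i ≡ false) l →
           (∀ i → lookup (updateWord conjunction w x) i ≡ true) → l ⊆ w
  true⇒⊆ {[]}    w  x _ _             _    = minimum w
  true⇒⊆ {a ∷ l} [] x _ (xₐ≡false ∷ _) true′ = case trans (sym xₐ≡false) (true′ a) of λ ()
  true⇒⊆ {a ∷ l} (j ∷ w) x (Ra ∷ Rl) (xₐ≡false ∷ xₗ≡false) true′ with a ≟ j
  ... | yes refl = refl ∷ true⇒⊆ w _ Rl tail′ true′
    where
    tail′ : All (λ i → lookup (update conjunction a x) i ≡ false) l
    tail′ = All.zipWith
      -- The head does not recur in the tail, since `R` is irreflexive.
      (λ { (Rab , x≡false) → trans (lookup∘update′ (λ { refl → wf⇒asym wf Rab Rab }) x _) x≡false })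
      (Ra , xₗ≡false)
  ... | no a≢j = j ∷ʳ true⇒⊆ w _ (Ra ∷ Rl)
      (trans (lookup∘update′ a≢j x _) xₐ≡false ∷ All.zipWith tail′ (Ra , xₗ≡false)) true′
    where
    tail′ : ∀ {b} → R a b × lookup x b ≡ false → lookup (update conjunction j x) b ≡ false
    tail′ {b} (Rab , x≡false) with b ≟ j
    ... | yes refl = trans (lookup∘update b x _) (false-predecessor x Rab xₐ≡false)
    ... | no  b≢j  = trans (lookup∘update′ b≢j x _) x≡false

fixesAllAcyclic⇒complete : (w : Word n) → FixesAllAcyclic w → Complete w
fixesAllAcyclic⇒complete w fixes π = true⇒⊆ w allFalse
  (AllPairs.tabulate⁺-< inverse-preserves-<)
  (All.tabulate λ {i} _ → lookup-replicate i false)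
  (fixedPoint⇒true (fixes conjunction acyclic allFalse))
  where
  -- `π ⟨$⟩ˡ i` is the position of `i` in the word of `π`, so `R` is precedence in that word.
  open Conjunctive {R = Fin._<_ on (π ⟨$⟩ˡ_)} (λ i j → (π ⟨$⟩ˡ i) <? (π ⟨$⟩ˡ j))
    (On.wellFounded (π ⟨$⟩ˡ_) <-wellFounded)

  allFalse = Vec.replicate _ false

  inverse-preserves-< : ∀ {i j} → i Fin.< j → (π ⟨$⟩ˡ (π ⟨$⟩ʳ i)) Fin.< (π ⟨$⟩ˡ (π ⟨$⟩ʳ j))
  inverse-preserves-< {i} {j} i<j rewrite inverseˡ π {i} | inverseˡ π {j} = i<j

fixesAllAcyclic⇔complete : (w : Word n) → FixesAllAcyclic w ⇔ Complete w
fixesAllAcyclic⇔complete w = mk⇔ (fixesAllAcyclic⇒complete w) (complete⇒fixesAllAcyclic w)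

-- Words of minimal length

insert-cong : ∀ (j : Fin (suc n)) {π ρ : Permutation′ n} → π ≈ ρ → insert zero j π ≈ insert zero j ρ
insert-cong j         π≈ρ zero    = refl
insert-cong j {π} {ρ} π≈ρ (suc k) = trans (insert-punchIn zero j π k)
  (trans (cong (punchIn j) (π≈ρ k)) (sym (insert-punchIn zero j ρ k)))

-- Recursion on the image of `zero` and the permutation left after removing it. Reinserting recovers
-- the original only up to `≈`, so `P` has to respect `≈`.
allPermutations? : ∀ n {P : Pred (Permutation′ n) 0ℓ} → (∀ {π ρ} → π ≈ ρ → P π → P ρ) →
                   Decidable P → Dec (∀ π → P π)
allPermutations? zero    resp P? = map′ (λ p π → resp (λ ()) p) (λ p → p Perm.id) (P? Perm.id)
allPermutations? (suc n) resp P? = map′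
  (λ p π → resp (insert-remove zero π) (p (π ⟨$⟩ʳ zero) (remove zero π)))
  (λ p j π → p (insert zero j π))
  (all? λ j → allPermutations? n (λ {π} {ρ} π≈ρ → resp (insert-cong j {π} {ρ} π≈ρ))
                                 (λ π → P? (insert zero j π)))

complete? : Decidable (Complete {n})
complete? w = allPermutations? _ (λ π≈ρ → subst (_⊆ w) (tabulate-cong π≈ρ))
  (λ π → permutationWord π ⊆? w)
  where open import Data.List.Relation.Binary.Sublist.DecPropositional _≟_ using (_⊆?_)

anyVec? : ∀ k {P : Pred (Vec (Fin n) k) 0ℓ} → Decidable P → Dec (∃[ v ] P v)
anyVec? zero    P? = map′ ([] ,_) (λ { ([] , p) → p }) (P? [])
anyVec? (suc k) P? = map′ (λ { (i , v , p) → i ∷ v , p }) (λ { (i ∷ v , p) → i , v , p })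
  (any? λ i → anyVec? k (P? ∘ (i ∷_)))

-- A search through the finitely many shorter words either finds one to continue from or certifies
-- minimality.
minLength : {P : Pred (Word n) 0ℓ} → Decidable P → ∃[ w ] P w → ∃[ k ] IsMinLength P k
minLength {n} {P} P? (w , Pw) = shorten w Pw (ℕ.<-wellFounded (length w))
  where
  shorten : ∀ w → P w → Acc _<_ (length w) → ∃[ k ] IsMinLength P k
  shorten w Pw (acc rs) with anyUpTo? (λ k → anyVec? k (P? ∘ toList)) (length w)
  ... | yes (k , k< , v , Pv) =
    shorten (toList v) Pv (rs (subst (_< length w) (sym (length-toList v)) k<))
  ... | no ∄shorter = length w , (w , Pw , refl) , λ u Pu → ≮⇒≥ λ u<w →
    ∄shorter (length u , u<w , fromList u , subst P (sym (toList∘fromList u)) Pu)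

-- Each copy of the alphabet supplies one letter of `l`.
⊆-repeated-allFin : (l : Word n) → l ⊆ concat (replicate (length l) (allFin n))
⊆-repeated-allFin []      = []
⊆-repeated-allFin (i ∷ l) = ++⁺ (from∈ (∈-allFin i)) (⊆-repeated-allFin l)

completeWord : ∀ n → ∃[ w ] Complete {n} w
completeWord n = concat (replicate n (allFin n)) , λ π →
  subst (λ k → permutationWord π ⊆ concat (replicate k (allFin n)))
    (length-tabulate (π ⟨$⟩ʳ_)) (⊆-repeated-allFin (permutationWord π))

isMinLength-⇔ : ∀ {P Q : Pred (Word n) 0ℓ} {k} → (∀ w → P w ⇔ Q w) →
                IsMinLength Q k → IsMinLength P k
isMinLength-⇔ P⇔Q ((w , Qw , eq) , least) =
  (w , Equivalence.from (P⇔Q w) Qw , eq) , λ v Pv → least v (Equivalence.to (P⇔Q v) Pv)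

proposition2 : (n : ℕ) → n ≥ 1 →
    ((w : Word n) → FixesAllAcyclic w ⇔ Complete w)
    × (∃[ k ] (IsλA n k × Isλ n k))
proposition2 n _ = fixesAllAcyclic⇔complete
  , map₂ (λ isλ → isMinLength-⇔ fixesAllAcyclic⇔complete isλ , isλ)
         (minLength complete? (completeWord n))
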